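{- For every integer $d\ge 1$, consider the random basic walk on the integer lattice $\mathbb{Z}^d$ (vertices $\mathbb{Z}^d$, edges between points at Euclidean distance $1$). For any starting vertex and any initial port, the random basic walk cycles with probability $1$.
   Context: Graphs are connected, countable and locally finite; each undirected edge $\{v,w\}$ is regarded as two arcs $v\to w$ and $w\to v$. A labeling assigns, at each vertex $v$ of degree $\deg(v)$, the port numbers $1,\dots,\deg(v)$ bijectively to the arcs leaving $v$ (labels on $v\to w$ and $w\to v$ need not agree). In a random labeling these bijections are chosen uniformly at random, independently for different vertices. Given a labeling, a starting vertex $v_0$ and an initial port $\ell$, the basic walk leaves $v_0$ along the arc labeled $\ell$; thereafter, whenever it enters a vertex $v$ along an arc whose label is $i$, it leaves $v$ along the arc out of $v$ labeled $(i \bmod \deg(v))+1$. The random basic walk is the basic walk for a random labeling. The walk cycles if some arc is traversed twice in the same direction (equivalently, from some point on it is periodic and visits only finitely many vertices); it is transient if it does not cycle, i.e. it visits infinitely many vertices, each only finitely often. -}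

module Defs where

open import Data.Empty using (⊥-elim)
open import Data.Fin.Base using (Fin; zero; suc; toℕ)
open import Data.Fin.Properties using (nonZeroIndex)
open import Data.Integer.Base as ℤ using (ℤ; +_; -[1+_]; ∣_∣; 0ℤ)
import Data.Integer.Properties as ℤ
open import Data.Integer.Tactic.RingSolver using (solve-∀)
open import Data.List.Base using (List; foldr; map)
open import Data.List.Relation.Unary.All using (All)
open import Data.List.Relation.Unary.Unique.Propositional using (Unique)
open import Data.Maybe.Base using (Maybe; just; nothing)
open import Data.Nat.Base as ℕ using (ℕ; zero; suc; _!)
open import Data.Nat.DivMod using (_mod_)
import Data.Nat.Properties as ℕ
open import Data.Product.Base using (Σ; ∃; _×_; _,_; proj₁; proj₂)
open import Data.Rational.Base as ℚ using (ℚ; 0ℚ; 1ℚ)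
open import Data.Sum.Base using (_⊎_; inj₁; inj₂)
open import Data.Vec.Base using (Vec; []; _∷_; sum; zipWith)
open import Data.Vec.Properties using (∷-injectiveˡ; ∷-injectiveʳ)
open import Function.Bundles using (_↔_; Inverse; mk↔ₛ′)
open import Relation.Binary.Construct.Closure.ReflexiveTransitive using (Star; ε; _◅_; _◅◅_; gmap; reverse)
open import Relation.Binary.Definitions using (Symmetric; Irreflexive; Irrelevant)
open import Relation.Binary.PropositionalEquality
open import Relation.Nullary.Negation.Core using (¬_)

-- Countability of V is not a field: it follows from connectedness and local
-- finiteness.
record Graph : Set₁ where
  field
    V              : Set
    Adj            : V → V → Set
    adj-irrelevant : Irrelevant Adj
    adj-sym        : Symmetric Adj
    adj-irrefl     : Irreflexive _≡_ Adj

  Out : V → Set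
  Out v = Σ V (Adj v)

  field
    connected     : ∀ v w → Star Adj v w
    deg           : V → ℕ
    locallyFinite : ∀ v → Fin (deg v) ↔ Out v

module BasicWalk (G : Graph) where
  open Graph G

  record Arc : Set where
    constructor arc
    field
      src : V
      tgt : V
      adj : Adj src tgt

  open Arc public

  -- Ports are numbered from 0: the element i of Fin (deg v) is port number
  -- 1 + toℕ i.
  LocalLabeling : V → Set
  LocalLabeling v = Fin (deg v) ↔ Out v

  Labeling : Set
  Labeling = ∀ v → LocalLabeling v

  leave : Labeling → (v : V) → Fin (deg v) → Arc
  leave ω v i = let (w , a) = Inverse.to (ω v) i in arc v w a

  label : Labeling → (e : Arc) → Fin (deg (src e))
  label ω e = Inverse.from (ω (src e)) (tgt e , adj e)

  deg-tgt≢0 : Labeling → (e : Arc) → ℕ.NonZero (deg (tgt e))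
  deg-tgt≢0 ω e = nonZeroIndex (Inverse.from (ω (tgt e)) (src e , adj-sym (adj e)))

  -- With ports numbered from 1, the port after i is (i mod deg v) + 1; here
  -- both i and the result are shifted down by one.
  next : Labeling → Arc → Arc
  next ω e = leave ω (tgt e) (_mod_ (suc (toℕ (label ω e))) (deg (tgt e)) {{deg-tgt≢0 ω e}})

  walk : Labeling → (v₀ : V) → Fin (deg v₀) → ℕ → Arc
  walk ω v₀ ℓ zero    = leave ω v₀ ℓ
  walk ω v₀ ℓ (suc t) = next ω (walk ω v₀ ℓ t)

  _≈ᵃ_ : Arc → Arc → Set
  e ≈ᵃ f = src e ≡ src f × tgt e ≡ tgt f

  Cycles : Labeling → (v₀ : V) → Fin (deg v₀) → Set
  Cycles ω v₀ ℓ = ∃ λ s → ∃ λ t → s ℕ.< t × walk ω v₀ ℓ s ≈ᵃ walk ω v₀ ℓ t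

-- The product, over all vertices v, of the uniform measures on the (deg v)!
-- bijections LocalLabeling v.
module RandomLabeling (G : Graph) where
  open Graph G
  open BasicWalk G

  record Cylinder : Set where
    field
      prescribed : List (Σ V LocalLabeling)
      distinct   : Unique (map proj₁ prescribed)

  open Cylinder public

  _∈ᶜ_ : Labeling → Cylinder → Set
  ω ∈ᶜ C = All (λ (v , π) → ∀ i → proj₁ (Inverse.to (ω v) i) ≡ proj₁ (Inverse.to π i)) (prescribed C)

  uniformMass : V → ℚ
  uniformMass v = ℚ._/_ (+ 1) (deg v !) {{deg v ℕ.!≢0}}

  μ : Cylinder → ℚ
  μ C = foldr (λ (v , _) q → uniformMass v ℚ.* q) 1ℚ (prescribed C)

  -- Cylinders together with the empty event (nothing).
  _∈ᵇ_ : Labeling → Maybe Cylinder → Set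
  ω ∈ᵇ B = ∃ λ C → B ≡ just C × ω ∈ᶜ C

  μᵇ : Maybe Cylinder → ℚ
  μᵇ (just C) = μ C
  μᵇ nothing  = 0ℚ

  partialSum : (ℕ → ℚ) → ℕ → ℚ
  partialSum f zero    = 0ℚ
  partialSum f (suc n) = partialSum f n ℚ.+ f n

  -- Outer measure zero: countable covers by cylinders of arbitrarily small
  -- total mass.
  Null : (Labeling → Set) → Set
  Null N = ∀ δ → 0ℚ ℚ.< δ → Σ (ℕ → Maybe Cylinder) λ B →
             (∀ n → partialSum (λ k → μᵇ (B k)) n ℚ.≤ δ) ×
             (∀ ω → N ω → ∃ λ n → ω ∈ᵇ B n)

  AlmostSurely : (Labeling → Set) → Set
  AlmostSurely E = Null (λ ω → ¬ E ω)

-- The square of the Euclidean distance.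
sqDist : ∀ {d} → Vec ℤ d → Vec ℤ d → ℕ
sqDist x y = sum (zipWith (λ a b → ∣ a ℤ.- b ∣ ℕ.^ 2) x y)

-- Euclidean distance 1 is the same as squared Euclidean distance 1.
LatticeAdj : ∀ {d} → Vec ℤ d → Vec ℤ d → Set
LatticeAdj x y = sqDist x y ≡ 1

sqDist-sym : ∀ {d} (x y : Vec ℤ d) → sqDist x y ≡ sqDist y x
sqDist-sym []      []      = refl
sqDist-sym (a ∷ x) (b ∷ y) = cong₂ (λ m n → m ℕ.^ 2 ℕ.+ n) (ℤ.∣i-j∣≡∣j-i∣ a b) (sqDist-sym x y)

a-a≡0 : ∀ a → ∣ a ℤ.- a ∣ ≡ 0
a-a≡0 a = cong ∣_∣ (ℤ.+-inverseʳ a)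

sqDist-refl : ∀ {d} (x : Vec ℤ d) → sqDist x x ≡ 0
sqDist-refl []      = refl
sqDist-refl (a ∷ x) = cong₂ (λ m n → m ℕ.^ 2 ℕ.+ n) (a-a≡0 a) (sqDist-refl x)

∣a-b∣≡0⇒a≡b : ∀ a b → ∣ a ℤ.- b ∣ ≡ 0 → a ≡ b
∣a-b∣≡0⇒a≡b a b p = ℤ.i-j≡0⇒i≡j a b (ℤ.∣i∣≡0⇒i≡0 p)

sqDist≡0⇒≡ : ∀ {d} (x y : Vec ℤ d) → sqDist x y ≡ 0 → x ≡ y
sqDist≡0⇒≡ []      []      _ = refl
sqDist≡0⇒≡ (a ∷ x) (b ∷ y) p with ∣ a ℤ.- b ∣ in eq
... | zero  = cong₂ _∷_ (∣a-b∣≡0⇒a≡b a b eq) (sqDist≡0⇒≡ x y p)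
... | suc _ with () ← p

lattice-irrefl : ∀ {d} → Irreflexive _≡_ (LatticeAdj {d})
lattice-irrefl {x = x} refl p with () ← trans (sym (sqDist-refl x)) p

-[a-b]+a≡b : ∀ a b → ℤ.- (a ℤ.- b) ℤ.+ a ≡ b
-[a-b]+a≡b = solve-∀

∣a-b∣≡1⇒ : ∀ a b → ∣ a ℤ.- b ∣ ≡ 1 → ℤ.suc a ≡ b ⊎ ℤ.pred a ≡ b
∣a-b∣≡1⇒ a b p with a ℤ.- b in eq
∣a-b∣≡1⇒ a b refl | + 1      = inj₂ (trans (cong (λ k → ℤ.- k ℤ.+ a) (sym eq)) (-[a-b]+a≡b a b))
∣a-b∣≡1⇒ a b refl | -[1+ 0 ] = inj₁ (trans (cong (λ k → ℤ.- k ℤ.+ a) (sym eq)) (-[a-b]+a≡b a b))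

a-suc≡-1 : ∀ a → a ℤ.- ℤ.suc a ≡ -[1+ 0 ]
a-suc≡-1 = lemma
  where
  lemma : ∀ a → a ℤ.- (+ 1 ℤ.+ a) ≡ -[1+ 0 ]
  lemma = solve-∀

a-pred≡1 : ∀ a → a ℤ.- ℤ.pred a ≡ + 1
a-pred≡1 = lemma
  where
  lemma : ∀ a → a ℤ.- (-[1+ 0 ] ℤ.+ a) ≡ + 1
  lemma = solve-∀

∣a-suc∣≡1 : ∀ a → ∣ a ℤ.- ℤ.suc a ∣ ≡ 1
∣a-suc∣≡1 a = cong ∣_∣ (a-suc≡-1 a)

∣a-pred∣≡1 : ∀ a → ∣ a ℤ.- ℤ.pred a ∣ ≡ 1
∣a-pred∣≡1 a = cong ∣_∣ (a-pred≡1 a)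

neighbor : ∀ {d} → Vec ℤ d → Fin (d ℕ.* 2) → Vec ℤ d
neighbor (a ∷ x) zero          = ℤ.suc a ∷ x
neighbor (a ∷ x) (suc zero)    = ℤ.pred a ∷ x
neighbor (a ∷ x) (suc (suc i)) = a ∷ neighbor x i

adj-head : ∀ {d} a b (x : Vec ℤ d) → ∣ a ℤ.- b ∣ ≡ 1 → LatticeAdj (a ∷ x) (b ∷ x)
adj-head a b x p = cong₂ (λ m n → m ℕ.^ 2 ℕ.+ n) p (sqDist-refl x)

adj-tail : ∀ {d} a (x y : Vec ℤ d) → LatticeAdj x y → LatticeAdj (a ∷ x) (a ∷ y)
adj-tail a x y p = cong₂ (λ m n → m ℕ.^ 2 ℕ.+ n) (a-a≡0 a) p

neighbor-adj : ∀ {d} (x : Vec ℤ d) i → LatticeAdj x (neighbor x i)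
neighbor-adj (a ∷ x) zero          = adj-head a (ℤ.suc a) x (∣a-suc∣≡1 a)
neighbor-adj (a ∷ x) (suc zero)    = adj-head a (ℤ.pred a) x (∣a-pred∣≡1 a)
neighbor-adj (a ∷ x) (suc (suc i)) = adj-tail a x (neighbor x i) (neighbor-adj x i)

neighbor-surjective : ∀ {d} (x y : Vec ℤ d) → LatticeAdj x y → ∃ λ i → neighbor x i ≡ y
neighbor-surjective []      []      ()
neighbor-surjective (a ∷ x) (b ∷ y) p with ∣ a ℤ.- b ∣ in eq
... | zero        = let (i , q) = neighbor-surjective x y p in
                    suc (suc i) , cong₂ _∷_ (∣a-b∣≡0⇒a≡b a b eq) q
... | suc (suc _) with () ← p
... | suc zero    with ∣a-b∣≡1⇒ a b eq | sqDist≡0⇒≡ x y (ℕ.suc-injective p)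
...   | inj₁ q | r = zero , cong₂ _∷_ q r
...   | inj₂ q | r = suc zero , cong₂ _∷_ q r

suc≢pred : ∀ a → ¬ ℤ.suc a ≡ ℤ.pred a
suc≢pred a p with () ← trans (sym (a-suc≡-1 a)) (trans (cong (λ b → a ℤ.- b) p) (a-pred≡1 a))

suc≢id : ∀ a → ¬ ℤ.suc a ≡ a
suc≢id a p with () ← trans (sym (∣a-suc∣≡1 a)) (trans (cong (λ b → ∣ a ℤ.- b ∣) p) (a-a≡0 a))

pred≢id : ∀ a → ¬ ℤ.pred a ≡ a
pred≢id a p with () ← trans (sym (∣a-pred∣≡1 a)) (trans (cong (λ b → ∣ a ℤ.- b ∣) p) (a-a≡0 a))

neighbor-injective : ∀ {d} (x : Vec ℤ d) i j → neighbor x i ≡ neighbor x j → i ≡ j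
neighbor-injective (a ∷ x) zero          zero          p = refl
neighbor-injective (a ∷ x) zero          (suc zero)    p = ⊥-elim (suc≢pred a (∷-injectiveˡ p))
neighbor-injective (a ∷ x) zero          (suc (suc j)) p = ⊥-elim (suc≢id a (∷-injectiveˡ p))
neighbor-injective (a ∷ x) (suc zero)    zero          p = ⊥-elim (suc≢pred a (sym (∷-injectiveˡ p)))
neighbor-injective (a ∷ x) (suc zero)    (suc zero)    p = refl
neighbor-injective (a ∷ x) (suc zero)    (suc (suc j)) p = ⊥-elim (pred≢id a (∷-injectiveˡ p))
neighbor-injective (a ∷ x) (suc (suc i)) zero          p = ⊥-elim (suc≢id a (sym (∷-injectiveˡ p)))
neighbor-injective (a ∷ x) (suc (suc i)) (suc zero)    p = ⊥-elim (pred≢id a (sym (∷-injectiveˡ p)))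
neighbor-injective (a ∷ x) (suc (suc i)) (suc (suc j)) p =
  cong (λ k → suc (suc k)) (neighbor-injective x i j (∷-injectiveʳ p))

neighbors : ∀ {d} (x : Vec ℤ d) → Fin (d ℕ.* 2) ↔ Σ (Vec ℤ d) (LatticeAdj x)
neighbors {d} x = mk↔ₛ′ to from to∘from from∘to
  where
  to : Fin (d ℕ.* 2) → Σ (Vec ℤ d) (LatticeAdj x)
  to i = neighbor x i , neighbor-adj x i

  from : Σ (Vec ℤ d) (LatticeAdj x) → Fin (d ℕ.* 2)
  from (y , p) = proj₁ (neighbor-surjective x y p)

  ext : ∀ {y z} (p : LatticeAdj x y) (q : LatticeAdj x z) → y ≡ z → (y , p) ≡ (z , q)
  ext p q refl = cong (_ ,_) (ℕ.≡-irrelevant p q)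

  to∘from : ∀ e → to (from e) ≡ e
  to∘from (y , p) = ext _ p (proj₂ (neighbor-surjective x y p))

  from∘to : ∀ i → from (to i) ≡ i
  from∘to i = neighbor-injective x _ i (proj₂ (neighbor-surjective x (neighbor x i) (neighbor-adj x i)))

lattice-sym : ∀ {d} → Symmetric (LatticeAdj {d})
lattice-sym {x = x} {y} p = trans (sqDist-sym y x) p

head-to-0 : ∀ {d} a (x : Vec ℤ d) → Star LatticeAdj (a ∷ x) (0ℤ ∷ x)
head-to-0 (+ zero)       x = ε
head-to-0 (+ suc n)      x = adj-head (+ suc n) (+ n) x (∣a-pred∣≡1 (+ suc n)) ◅ head-to-0 (+ n) x
head-to-0 -[1+ zero ]    x = adj-head -[1+ 0 ] 0ℤ x refl ◅ ε
head-to-0 -[1+ suc n ]   x = adj-head -[1+ suc n ] -[1+ n ] x (∣a-suc∣≡1 -[1+ suc n ]) ◅ head-to-0 -[1+ n ] x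

lattice-connected : ∀ {d} (x y : Vec ℤ d) → Star LatticeAdj x y
lattice-connected []      []      = ε
lattice-connected (a ∷ x) (b ∷ y) =
  gmap (a ∷_) (λ {u} {v} → adj-tail a u v) (lattice-connected x y) ◅◅
  head-to-0 a y ◅◅
  reverse (λ {u} {v} → lattice-sym {x = u} {v}) (head-to-0 b y)

ℤ^ : ℕ → Graph
ℤ^ d = record
  { V              = Vec ℤ d
  ; Adj            = LatticeAdj
  ; adj-irrelevant = ℕ.≡-irrelevant
  ; adj-sym        = λ {x} {y} → lattice-sym {x = x} {y}
  ; adj-irrefl     = lattice-irrefl
  ; connected      = lattice-connected
  ; deg            = λ _ → d ℕ.* 2
  ; locallyFinite  = neighbors
  }

{-# OPTIONS --safe #-}

-- All degrees equal 2d, so the port used at time t is ℓ + t modulo 2d and an arc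
-- is repeated as soon as a vertex is revisited after a multiple of 2d steps.
-- Reveal the labels only when they are needed.  A walk that stays in an ℓ¹-ball
-- cycles by the pigeonhole principle; otherwise, whenever it leaves a ball that
-- contains everything revealed so far, it stands on an unrevealed vertex x whose
-- d neighbours of larger norm are unrevealed too.  With conditional probability at
-- least c = ((2d)!)⁻⁽ᵈ⁺¹⁾ the walk then visits these neighbours one after the other,
-- returning to x after each, and is back at x with its initial port after 2d steps.
-- Hence it escapes k such traps with probability at most (1 - c)ᵏ.
module Submission where

open import Defs
open import Algebra.Bundles using (CommutativeRing)
import Algebra.Properties.Monoid.Mult as MonoidMult
import Algebra.Properties.Semiring.Exp as SemiringExp
import Algebra.Properties.Semiring.Mult as SemiringMult
open import Data.Fin.Base using (Fin; zero; suc; toℕ; fromℕ<; combine; join; punchIn; splitAt)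
open import Data.Fin.Permutation as Perm using (Permutation′; _⟨$⟩ʳ_; _∘ₚ_; insert; remove; transpose)
import Data.Fin.Properties as Fin
open import Data.Integer.Base as ℤ using (ℤ; +_; -[1+_]; ∣_∣)
import Data.Integer.Properties as ℤ
import Data.Integer.Tactic.RingSolver as ℤSolver
open import Data.List.Base using (List; []; _∷_; [_]; _++_; length; map; foldr; tabulate; cartesianProductWith; allFin)
open import Data.List.Membership.DecPropositional using (_∈?_)
open import Data.List.Membership.Propositional using (_∈_)
open import Data.List.Membership.Propositional.Properties using (∈-map⁻)
import Data.List.Properties as List
open import Data.List.Relation.Unary.All as All using (All; []; _∷_)
import Data.List.Relation.Unary.All.Properties as All
open import Data.List.Relation.Unary.AllPairs using ([]; _∷_)
open import Data.List.Relation.Unary.Any as Any using (Any; here; there)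
import Data.List.Relation.Unary.Any.Properties as Any
open import Data.List.Relation.Unary.Unique.Propositional using (Unique)
import Data.List.Relation.Unary.Unique.Propositional.Properties as Unique
open import Data.Maybe.Base using (Maybe; just; nothing)
open import Data.Nat.Base as ℕ using (ℕ; zero; suc; _≤_; _!)
open import Data.Nat.DivMod using (_mod_; _%_; %-distribˡ-+; [m+n]%n≡m%n; [m+kn]%n≡m%n; m<n⇒m%n≡m; m%n%n≡m%n)
import Data.Nat.Properties as ℕ
import Data.Nat.Tactic.RingSolver as ℕSolver
open import Data.Product.Base using (Σ; ∃; _×_; _,_; proj₁; proj₂)
open import Data.Rational.Base as ℚ using (ℚ; 0ℚ; 1ℚ; mkℚ; toℚᵘ)
import Data.Rational.Properties as ℚ
open import Data.Rational.Solver using (module +-*-Solver)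
import Data.Rational.Unnormalised.Base as ℚᵘ
import Data.Rational.Unnormalised.Properties as ℚᵘ
open import Data.Sum.Base using (_⊎_; inj₁; inj₂)
open import Data.Sum.Properties using (inj₁-injective; inj₂-injective)
open import Data.Vec.Base using (Vec; []; _∷_)
import Data.Vec.Properties as Vec
open import Function.Base using (_∘_)
open import Function.Bundles using (Injection; Inverse)
open import Function.Construct.Composition using (_↔-∘_)
open import Function.Construct.Symmetry using (↔-sym)
open import Function.Definitions using (Injective)
open import Function.Properties.Inverse using (↔⇒↣)
open import Relation.Binary.PropositionalEquality hiding ([_])
open import Relation.Nullary.Decidable using (yes; no; dec-true; dec-false)
open import Relation.Nullary.Negation using (¬_; contradiction)

open MonoidMult ℚ.+-0-monoid using () renaming (_×_ to _·_)
open SemiringMult (CommutativeRing.semiring ℚ.+-*-commutativeRing) using (×-assoc-*)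
open SemiringExp (CommutativeRing.semiring ℚ.+-*-commutativeRing) using (_^_)

-- Rational arithmetic, up to the decay of the powers of 1 - c.

0≤-+ : ∀ {p q} → 0ℚ ℚ.≤ p → 0ℚ ℚ.≤ q → 0ℚ ℚ.≤ p ℚ.+ q
0≤-+ 0≤p 0≤q = ℚ.+-mono-≤ 0≤p 0≤q

0≤-* : ∀ {p q} → 0ℚ ℚ.≤ p → 0ℚ ℚ.≤ q → 0ℚ ℚ.≤ p ℚ.* q
0≤-* {p} {q} 0≤p 0≤q =
  ℚ.nonNegative⁻¹ _ {{ℚ.nonNeg*nonNeg⇒nonNeg p {{ℚ.nonNegative 0≤p}} q {{ℚ.nonNegative 0≤q}}}}

0≤-· : ∀ k {p} → 0ℚ ℚ.≤ p → 0ℚ ℚ.≤ k · p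
0≤-· zero    0≤p = ℚ.≤-refl
0≤-· (suc k) 0≤p = 0≤-+ 0≤p (0≤-· k 0≤p)

0<-* : ∀ {p q} → 0ℚ ℚ.< p → 0ℚ ℚ.< q → 0ℚ ℚ.< p ℚ.* q
0<-* {p} {q} 0<p 0<q = ℚ.positive⁻¹ _ {{ℚ.pos*pos⇒pos p {{ℚ.positive 0<p}} q {{ℚ.positive 0<q}}}}

0<-^ : ∀ {p} k → 0ℚ ℚ.< p → 0ℚ ℚ.< p ^ k
0<-^ zero    0<p = ℚ.positive⁻¹ 1ℚ
0<-^ (suc k) 0<p = 0<-* 0<p (0<-^ k 0<p)

·-monoʳ-≤ : ∀ k {p q} → p ℚ.≤ q → k · p ℚ.≤ k · q
·-monoʳ-≤ zero    p≤q = ℚ.≤-refl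
·-monoʳ-≤ (suc k) p≤q = ℚ.+-mono-≤ p≤q (·-monoʳ-≤ k p≤q)

/-+ : ∀ a b n .{{_ : ℕ.NonZero n}} → a ℚ./ n ℚ.+ b ℚ./ n ≡ (a ℤ.+ b) ℚ./ n
/-+ a b (suc n-1) = ℚ.toℚᵘ-injective (begin
  toℚᵘ (a ℚ./ n ℚ.+ b ℚ./ n)          ≈⟨ ℚ.toℚᵘ-homo-+ (a ℚ./ n) (b ℚ./ n) ⟩
  toℚᵘ (a ℚ./ n) ℚᵘ.+ toℚᵘ (b ℚ./ n)  ≈⟨ ℚᵘ.+-cong (ℚ.toℚᵘ-fromℚᵘ (ℚᵘ.mkℚᵘ a n-1))
                                                    (ℚ.toℚᵘ-fromℚᵘ (ℚᵘ.mkℚᵘ b n-1)) ⟩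
  ℚᵘ.mkℚᵘ a n-1 ℚᵘ.+ ℚᵘ.mkℚᵘ b n-1    ≈⟨ ℚᵘ.*≡* (cross a b (+ n)) ⟩
  ℚᵘ.mkℚᵘ (a ℤ.+ b) n-1               ≈⟨ ℚ.toℚᵘ-fromℚᵘ (ℚᵘ.mkℚᵘ (a ℤ.+ b) n-1) ⟨
  toℚᵘ ((a ℤ.+ b) ℚ./ n)              ∎)
  where
  open ℚᵘ.≃-Reasoning
  n = suc n-1
  cross : ∀ a b n → (a ℤ.* n ℤ.+ b ℤ.* n) ℤ.* n ≡ (a ℤ.+ b) ℤ.* (n ℤ.* n)
  cross = ℤSolver.solve-∀

·-unitFraction : ∀ k n .{{_ : ℕ.NonZero n}} → k · (+ 1 ℚ./ n) ≡ + k ℚ./ n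
·-unitFraction zero    (suc n-1) = ℚ.fromℚᵘ-cong {ℚᵘ.mkℚᵘ (+ 0) 0} {ℚᵘ.mkℚᵘ (+ 0) n-1} (ℚᵘ.*≡* refl)
·-unitFraction (suc k) n = trans (cong (+ 1 ℚ./ n ℚ.+_) (·-unitFraction k n)) (/-+ (+ 1) (+ k) n)

n·1/n≡1 : ∀ n .{{_ : ℕ.NonZero n}} → n · (+ 1 ℚ./ n) ≡ 1ℚ
n·1/n≡1 n@(suc n-1) = trans (·-unitFraction n n)
  (ℚ.fromℚᵘ-cong {ℚᵘ.mkℚᵘ (+ n) n-1} {ℚᵘ.mkℚᵘ (+ 1) 0} (ℚᵘ.*≡* (ℤ.*-comm (+ n) (+ 1))))

0<1/n : ∀ n .{{_ : ℕ.NonZero n}} → 0ℚ ℚ.< + 1 ℚ./ n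
0<1/n n = ℚ.positive⁻¹ _ {{ℚ.normalize-pos 1 n}}

-- A positive rational (a + 1)/(b + 1) is at least 1/(b + 1), so b + 1 copies of it reach 1.
archimedean : ∀ p → 0ℚ ℚ.< p → ∃ λ k → 1ℚ ℚ.≤ k · p
archimedean p@(mkℚ (+ suc a) b _) _ = suc b ,
  ℚ.≤-trans (ℚ.≤-reflexive (sym (n·1/n≡1 (suc b)))) (·-monoʳ-≤ (suc b) 1/b≤p)
  where
  1/b≤p : + 1 ℚ./ suc b ℚ.≤ p
  1/b≤p = ℚ.toℚᵘ-cancel-≤ (ℚᵘ.≤-respˡ-≃ (ℚᵘ.≃-sym (ℚ.toℚᵘ-fromℚᵘ (ℚᵘ.mkℚᵘ (+ 1) b)))
    (ℚᵘ.*≤* (ℤ.*-monoʳ-≤-nonNeg (+ suc b) (ℤ.+≤+ (ℕ.s≤s (ℕ.z≤n {a}))))))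
archimedean (mkℚ (+ zero)   _ _) 0<p with () ← ℚ.positive 0<p
archimedean (mkℚ -[1+ _ ] _ _) 0<p with () ← ℚ.positive 0<p

m·p≡1-p : ∀ m {p} → suc m · p ≡ 1ℚ → m · p ≡ 1ℚ ℚ.- p
m·p≡1-p m {p} eq = trans (solve 2 (λ x y → y := x :+ y :+ :- x) refl p (m · p)) (cong (ℚ._- p) eq)
  where open +-*-Solver

0≤1-unitFraction : ∀ n .{{_ : ℕ.NonZero n}} → 0ℚ ℚ.≤ 1ℚ ℚ.- + 1 ℚ./ n
0≤1-unitFraction n@(suc m) =
  subst (0ℚ ℚ.≤_) (m·p≡1-p m (n·1/n≡1 n)) (0≤-· m (ℚ.<⇒≤ (0<1/n n)))

-- The recursion for a trap that needs `suc k` right labels, each of probability `p`: a wrong first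
-- label leaves the bound `q`, a right one leaves a trap with `k` labels to go.
1-^-step : ∀ p q k → (1ℚ ℚ.- p) ℚ.* q ℚ.+ p ℚ.* ((1ℚ ℚ.- p ^ k) ℚ.* q) ≡ (1ℚ ℚ.- p ^ suc k) ℚ.* q
1-^-step p q k = solve 3 (λ x y z →
  (con 1ℚ :- x) :* y :+ x :* ((con 1ℚ :- z) :* y) := (con 1ℚ :- x :* z) :* y) refl p q (p ^ k)
  where open +-*-Solver

0≤1-^ : ∀ {p} k → 0ℚ ℚ.≤ p → 0ℚ ℚ.≤ 1ℚ ℚ.- p → 0ℚ ℚ.≤ 1ℚ ℚ.- p ^ k
0≤1-^ zero        0≤p 0≤1-p = ℚ.≤-refl
0≤1-^ {p} (suc k) 0≤p 0≤1-p = subst (0ℚ ℚ.≤_) (trans (1-^-step p 1ℚ k) (ℚ.*-identityʳ _))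
  (0≤-+ (0≤-* 0≤1-p (ℚ.nonNegative⁻¹ 1ℚ)) (0≤-* 0≤p (0≤-* (0≤1-^ k 0≤p 0≤1-p) (ℚ.nonNegative⁻¹ 1ℚ))))

0≤-^ : ∀ {p} k → 0ℚ ℚ.≤ p → 0ℚ ℚ.≤ p ^ k
0≤-^ zero    0≤p = ℚ.nonNegative⁻¹ 1ℚ
0≤-^ (suc k) 0≤p = 0≤-* 0≤p (0≤-^ k 0≤p)

-- The Bernoulli-type bound (1 - c)^k ≤ 1/(1 + kc), written without division. From k to k + 1 the
-- left side drops by the nonnegative amount (k + 1) c² (1 - c)^k.
bernoulli : ∀ {c} k → 0ℚ ℚ.≤ c → 0ℚ ℚ.≤ 1ℚ ℚ.- c → (1ℚ ℚ.+ k · c) ℚ.* (1ℚ ℚ.- c) ^ k ℚ.≤ 1ℚ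
bernoulli     zero    0≤c 0≤1-c = ℚ.≤-refl
bernoulli {c} (suc k) 0≤c 0≤1-c = begin
  kept                                        ≡⟨ ℚ.+-identityʳ kept ⟨
  kept ℚ.+ 0ℚ                                 ≤⟨ ℚ.+-monoʳ-≤ kept 0≤loss ⟩
  kept ℚ.+ (c ℚ.+ k · c) ℚ.* c ℚ.* q          ≡⟨ telescope c (k · c) q ⟩
  (1ℚ ℚ.+ k · c) ℚ.* q                        ≤⟨ bernoulli k 0≤c 0≤1-c ⟩
  1ℚ                                          ∎
  where
  open ℚ.≤-Reasoning
  q = (1ℚ ℚ.- c) ^ k
  kept = (1ℚ ℚ.+ (c ℚ.+ k · c)) ℚ.* ((1ℚ ℚ.- c) ℚ.* q)
  0≤loss : 0ℚ ℚ.≤ (c ℚ.+ k · c) ℚ.* c ℚ.* q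
  0≤loss = 0≤-* (0≤-* (0≤-· (suc k) 0≤c) 0≤c) (0≤-^ k 0≤1-c)
  telescope : ∀ c s q →
    (1ℚ ℚ.+ (c ℚ.+ s)) ℚ.* ((1ℚ ℚ.- c) ℚ.* q) ℚ.+ (c ℚ.+ s) ℚ.* c ℚ.* q ≡ (1ℚ ℚ.+ s) ℚ.* q
  telescope = solve 3 (λ c s q →
    (con 1ℚ :+ (c :+ s)) :* ((con 1ℚ :- c) :* q) :+ (c :+ s) :* c :* q := (con 1ℚ :+ s) :* q) refl
    where open +-*-Solver

-- Take k with kcδ ≥ 1. If (1 - c)^k exceeded δ, then 1 < (1 + kc) δ ≤ (1 + kc)(1 - c)^k ≤ 1.
powers-vanish : ∀ c δ → 0ℚ ℚ.< c → 0ℚ ℚ.≤ 1ℚ ℚ.- c → 0ℚ ℚ.< δ → ∃ λ k → (1ℚ ℚ.- c) ^ k ℚ.≤ δ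
powers-vanish c δ 0<c 0≤1-c 0<δ with archimedean (c ℚ.* δ) (0<-* 0<c 0<δ)
... | k , 1≤kcδ = k , ℚ.≮⇒≥ δ≮q
  where
  open ℚ.≤-Reasoning
  q = (1ℚ ℚ.- c) ^ k
  instance
    1+kc≥0 : ℚ.NonNegative (1ℚ ℚ.+ k · c)
    1+kc≥0 = ℚ.nonNegative (0≤-+ (ℚ.nonNegative⁻¹ 1ℚ) (0≤-· k (ℚ.<⇒≤ 0<c)))
  δ≮q : ¬ δ ℚ.< q
  δ≮q δ<q = ℚ.<-irrefl refl (begin-strict
    1ℚ                            ≡⟨ ℚ.+-identityˡ 1ℚ ⟨
    0ℚ ℚ.+ 1ℚ                     <⟨ ℚ.+-mono-<-≤ 0<δ 1≤kcδ ⟩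
    δ ℚ.+ k · (c ℚ.* δ)           ≡⟨ cong₂ ℚ._+_ (ℚ.*-identityˡ δ) (×-assoc-* k c δ) ⟨
    1ℚ ℚ.* δ ℚ.+ (k · c) ℚ.* δ    ≡⟨ ℚ.*-distribʳ-+ δ 1ℚ (k · c) ⟨
    (1ℚ ℚ.+ k · c) ℚ.* δ          ≤⟨ ℚ.*-monoˡ-≤-nonNeg (1ℚ ℚ.+ k · c) (ℚ.<⇒≤ δ<q) ⟩
    (1ℚ ℚ.+ k · c) ℚ.* q          ≤⟨ bernoulli k (ℚ.<⇒≤ 0<c) 0≤1-c ⟩
    1ℚ                            ∎)

-- Enumerating and extending permutations.

length-cartesianProductWith : ∀ {A B C : Set} (f : A → B → C) xs ys →
  length (cartesianProductWith f xs ys) ≡ length xs ℕ.* length ys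
length-cartesianProductWith f []       ys = refl
length-cartesianProductWith f (x ∷ xs) ys = trans (List.length-++ (map (f x) ys))
  (cong₂ ℕ._+_ (List.length-map (f x) ys) (length-cartesianProductWith f xs ys))

permutations : ∀ n → List (Permutation′ n)
permutations zero    = [ Perm.id ]
permutations (suc n) = cartesianProductWith (insert zero) (allFin (suc n)) (permutations n)

length-permutations : ∀ n → length (permutations n) ≡ n !
length-permutations zero    = refl
length-permutations (suc n) = trans
  (length-cartesianProductWith (insert zero) (allFin (suc n)) (permutations n))
  (cong₂ ℕ._*_ (List.length-tabulate {n = suc n} (λ i → i)) (length-permutations n))

-- The image of `zero` and the permutation left after removing `zero` determine all values of `π`.
-- The match is pointwise, which is all that cylinders can see.
permutations-complete : ∀ n (π : Permutation′ n) → Any (π Perm.≈_) (permutations n)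
permutations-complete zero    π = here λ ()
permutations-complete (suc n) π = Any.cartesianProductWith⁺ (insert zero) inserted
  (Any.tabulate⁺ {f = λ i → i} (π ⟨$⟩ʳ zero) refl) (permutations-complete n (remove zero π))
  where
  inserted : ∀ {j ρ} → π ⟨$⟩ʳ zero ≡ j → remove zero π Perm.≈ ρ → π Perm.≈ insert zero j ρ
  inserted refl eq zero    = refl
  inserted refl eq (suc i) =
    trans (sym (Perm.insert-remove zero π (suc i))) (cong (punchIn (π ⟨$⟩ʳ zero)) (eq i))

transpose-matchˡ : ∀ {n} (i j : Fin n) → transpose i j ⟨$⟩ʳ i ≡ j
transpose-matchˡ i j rewrite dec-true (i Fin.≟ i) refl = refl

transpose-mismatch : ∀ {n} {i j k : Fin n} → k ≢ i → k ≢ j → transpose i j ⟨$⟩ʳ k ≡ k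
transpose-mismatch {i = i} {j} {k} k≢i k≢j
  rewrite dec-false (k Fin.≟ i) k≢i | dec-false (k Fin.≟ j) k≢j = refl

-- After `σ′` has aligned the tails, a transposition sends the image of `f zero` to `g zero`; by
-- injectivity it fixes every value already aligned.
extendInjection : ∀ {n} k (f g : Fin k → Fin n) → Injective _≡_ _≡_ f → Injective _≡_ _≡_ g →
  ∃ λ (σ : Permutation′ n) → ∀ j → σ ⟨$⟩ʳ f j ≡ g j
extendInjection zero    f g f-inj g-inj = Perm.id , λ ()
extendInjection {n} (suc k) f g f-inj g-inj = σ , σ∘f≗g
  where
  IH = extendInjection k (f ∘ suc) (g ∘ suc) (Fin.suc-injective ∘ f-inj) (Fin.suc-injective ∘ g-inj)
  σ′ = proj₁ IH
  σ : Permutation′ n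
  σ = σ′ ∘ₚ transpose (σ′ ⟨$⟩ʳ f zero) (g zero)
  σ∘f≗g : ∀ j → σ ⟨$⟩ʳ f j ≡ g j
  σ∘f≗g zero    = transpose-matchˡ (σ′ ⟨$⟩ʳ f zero) (g zero)
  σ∘f≗g (suc j) = trans (transpose-mismatch σ′fj≢σ′f0 σ′fj≢g0) (proj₂ IH j)
    where
    σ′fj≢σ′f0 : σ′ ⟨$⟩ʳ f (suc j) ≢ σ′ ⟨$⟩ʳ f zero
    σ′fj≢σ′f0 eq with () ← f-inj (Injection.injective (↔⇒↣ σ′) eq)
    σ′fj≢g0 : σ′ ⟨$⟩ʳ f (suc j) ≢ g zero
    σ′fj≢g0 eq with () ← g-inj (trans (sym (proj₂ IH j)) eq)

-- Congruences modulo n.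

%-cong-+ : ∀ a b c n .{{_ : ℕ.NonZero n}} → a % n ≡ b % n → (a ℕ.+ c) % n ≡ (b ℕ.+ c) % n
%-cong-+ a b c n eq = begin
  (a ℕ.+ c) % n            ≡⟨ %-distribˡ-+ a c n ⟩
  (a % n ℕ.+ c % n) % n    ≡⟨ cong (λ r → (r ℕ.+ c % n) % n) eq ⟩
  (b % n ℕ.+ c % n) % n    ≡⟨ %-distribˡ-+ b c n ⟨
  (b ℕ.+ c) % n            ∎
  where open ≡-Reasoning

-- Adding m * (n - 1) to both sides turns m into a multiple of n.
%-cancelˡ-+ : ∀ m {i j} n .{{_ : ℕ.NonZero n}} → (m ℕ.+ i) % n ≡ (m ℕ.+ j) % n → i % n ≡ j % n
%-cancelˡ-+ m {i} {j} n@(suc n-1) eq = begin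
  i % n                         ≡⟨ absorb i ⟨
  (m ℕ.+ i ℕ.+ m ℕ.* n-1) % n   ≡⟨ %-cong-+ (m ℕ.+ i) (m ℕ.+ j) (m ℕ.* n-1) n eq ⟩
  (m ℕ.+ j ℕ.+ m ℕ.* n-1) % n   ≡⟨ absorb j ⟩
  j % n                         ∎
  where
  open ≡-Reasoning
  rearrange : ∀ m i p → m ℕ.+ i ℕ.+ m ℕ.* p ≡ i ℕ.+ m ℕ.* suc p
  rearrange = ℕSolver.solve-∀
  absorb : ∀ i → (m ℕ.+ i ℕ.+ m ℕ.* n-1) % n ≡ i % n
  absorb i = trans (cong (_% n) (rearrange m i n-1)) ([m+kn]%n≡m%n i m n)

-- The ℓ¹ norm and the finiteness of its balls.

norm : ∀ {d} → Vec ℤ d → ℕ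
norm []      = 0
norm (a ∷ x) = ∣ a ∣ ℕ.+ norm x

-- Selects, in the numbering of `neighbor`, the direction that moves coordinate `j` away from 0; a
-- coordinate equal to 0 moves to 1.
outward : ∀ {d} → Vec ℤ d → Fin d → Fin (d ℕ.* 2)
outward (_        ∷ x) (suc j) = suc (suc (outward x j))
outward (+ _      ∷ x) zero    = zero
outward (-[1+ _ ] ∷ x) zero    = suc zero

outward-injective : ∀ {d} (x : Vec ℤ d) → Injective _≡_ _≡_ (outward x)
outward-injective (_        ∷ x) {zero}  {zero}  eq = refl
outward-injective (+ _      ∷ x) {zero}  {suc j} ()
outward-injective (-[1+ _ ] ∷ x) {zero}  {suc j} ()
outward-injective (+ _      ∷ x) {suc i} {zero}  ()
outward-injective (-[1+ _ ] ∷ x) {suc i} {zero}  ()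
outward-injective (_        ∷ x) {suc i} {suc j} eq =
  cong suc (outward-injective x (Fin.suc-injective (Fin.suc-injective eq)))

norm-outward : ∀ {d} (x : Vec ℤ d) j → norm (neighbor x (outward x j)) ≡ suc (norm x)
norm-outward (+ _      ∷ x) zero    = refl
norm-outward (-[1+ _ ] ∷ x) zero    = refl
norm-outward (a        ∷ x) (suc j) =
  trans (cong (∣ a ∣ ℕ.+_) (norm-outward x j)) (ℕ.+-suc ∣ a ∣ (norm x))

-- One copy of `Fin (suc R)` for each sign: slightly more codes than integers, but injectivity is
-- all that the pigeonhole principle asks for.
signedCode : ∀ {R} a → ∣ a ∣ ℕ.≤ R → Fin (suc R) ⊎ Fin (suc R)
signedCode (+ n)    n≤R = inj₁ (fromℕ< (ℕ.s≤s n≤R))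
signedCode -[1+ n ] n<R = inj₂ (fromℕ< (ℕ.m≤n⇒m≤1+n n<R))

signedCode-injective : ∀ {R} a b (p : ∣ a ∣ ℕ.≤ R) (q : ∣ b ∣ ℕ.≤ R) →
  signedCode a p ≡ signedCode b q → a ≡ b
signedCode-injective (+ m)    (+ n)    p q eq =
  cong +_ (Fin.fromℕ<-injective m n _ _ (inj₁-injective eq))
signedCode-injective -[1+ m ] -[1+ n ] p q eq =
  cong -[1+_] (Fin.fromℕ<-injective m n _ _ (inj₂-injective eq))
signedCode-injective (+ _)    -[1+ _ ] p q ()
signedCode-injective -[1+ _ ] (+ _)    p q ()

join-injective : ∀ m n {i j : Fin m ⊎ Fin n} → join m n i ≡ join m n j → i ≡ j
join-injective m n {i} {j} eq =
  trans (sym (Fin.splitAt-join m n i)) (trans (cong (splitAt m) eq) (Fin.splitAt-join m n j))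

encode : ∀ {d R} (x : Vec ℤ d) → norm x ℕ.≤ R → Fin ((suc R ℕ.+ suc R) ℕ.^ d)
encode         []      _ = zero
encode {R = R} (a ∷ x) p = combine
  (join (suc R) (suc R) (signedCode a (ℕ.m+n≤o⇒m≤o ∣ a ∣ p)))
  (encode x (ℕ.m+n≤o⇒n≤o ∣ a ∣ p))

encode-injective : ∀ {d R} (x y : Vec ℤ d) (p : norm x ℕ.≤ R) (q : norm y ℕ.≤ R) →
  encode x p ≡ encode y q → x ≡ y
encode-injective         []      []      _ _ _  = refl
encode-injective {R = R} (a ∷ x) (b ∷ y) p q eq with Fin.combine-injective _ _ _ _ eq
... | eqˡ , eqʳ = cong₂ _∷_
  (signedCode-injective a b _ _ (join-injective (suc R) (suc R) eqˡ))
  (encode-injective x y _ _ eqʳ)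

-- The walk from a fixed start: ports, positions and repeated arcs.

module LatticeWalk (d : ℕ) (v₀ : Vec ℤ d) (ℓ : Fin (d ℕ.* 2)) where

  open BasicWalk (ℤ^ d)
  open RandomLabeling (ℤ^ d)

  n : ℕ
  n = d ℕ.* 2

  instance
    n≢0 : ℕ.NonZero n
    n≢0 = Fin.nonZeroIndex ℓ

  Site : Set
  Site = Vec ℤ d

  port : ℕ → Fin n
  port zero    = ℓ
  port (suc t) = suc (toℕ (port t)) mod n

  toℕ-port : ∀ t → toℕ (port t) ≡ (toℕ ℓ ℕ.+ t) % n
  toℕ-port zero    = sym (trans (cong (_% n) (ℕ.+-identityʳ (toℕ ℓ))) (m<n⇒m%n≡m (Fin.toℕ<n ℓ)))
  toℕ-port (suc t) = begin
    toℕ (suc (toℕ (port t)) mod n)     ≡⟨ Fin.toℕ-fromℕ< _ ⟩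
    suc (toℕ (port t)) % n             ≡⟨ cong (λ r → suc r % n) (toℕ-port t) ⟩
    (1 ℕ.+ (toℕ ℓ ℕ.+ t) % n) % n      ≡⟨ cong (_% n) (ℕ.+-comm 1 ((toℕ ℓ ℕ.+ t) % n)) ⟩
    ((toℕ ℓ ℕ.+ t) % n ℕ.+ 1) % n
      ≡⟨ %-cong-+ ((toℕ ℓ ℕ.+ t) % n) (toℕ ℓ ℕ.+ t) 1 n (m%n%n≡m%n (toℕ ℓ ℕ.+ t) n) ⟩
    (toℕ ℓ ℕ.+ t ℕ.+ 1) % n
      ≡⟨ cong (_% n) (trans (ℕ.+-assoc (toℕ ℓ) t 1) (cong (toℕ ℓ ℕ.+_) (ℕ.+-comm t 1))) ⟩
    (toℕ ℓ ℕ.+ suc t) % n              ∎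
    where open ≡-Reasoning

  port-periodic : ∀ t → port (n ℕ.+ t) ≡ port t
  port-periodic t = Fin.toℕ-injective (begin
    toℕ (port (n ℕ.+ t))          ≡⟨ toℕ-port (n ℕ.+ t) ⟩
    (toℕ ℓ ℕ.+ (n ℕ.+ t)) % n     ≡⟨ cong (λ s → (toℕ ℓ ℕ.+ s) % n) (ℕ.+-comm n t) ⟩
    (toℕ ℓ ℕ.+ (t ℕ.+ n)) % n     ≡⟨ cong (_% n) (ℕ.+-assoc (toℕ ℓ) t n) ⟨
    (toℕ ℓ ℕ.+ t ℕ.+ n) % n       ≡⟨ [m+n]%n≡m%n (toℕ ℓ ℕ.+ t) n ⟩
    (toℕ ℓ ℕ.+ t) % n             ≡⟨ toℕ-port t ⟨
    toℕ (port t)                  ∎)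
    where open ≡-Reasoning

  -- The ports of n consecutive times are distinct, so labels for several departures from one vertex
  -- can be prescribed without conflict.
  port-injective : ∀ t {i j} → i ℕ.< n → j ℕ.< n → port (i ℕ.+ t) ≡ port (j ℕ.+ t) → i ≡ j
  port-injective t {i} {j} i<n j<n eq =
    trans (sym (m<n⇒m%n≡m i<n)) (trans
      (%-cancelˡ-+ (toℕ ℓ ℕ.+ t) n (trans (sym (shifted i)) (trans (cong toℕ eq) (shifted j))))
      (m<n⇒m%n≡m j<n))
    where
    shifted : ∀ i → toℕ (port (i ℕ.+ t)) ≡ (toℕ ℓ ℕ.+ t ℕ.+ i) % n
    shifted i = trans (toℕ-port (i ℕ.+ t))
      (cong (_% n) (trans (cong (toℕ ℓ ℕ.+_) (ℕ.+-comm i t)) (sym (ℕ.+-assoc (toℕ ℓ) t i))))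

  exit : ∀ v → LocalLabeling v → Fin n → Site
  exit v π i = proj₁ (Inverse.to π i)

  step : Labeling → Site → Fin n → Site
  step ω v = exit v (ω v)

  position : Labeling → ℕ → Site
  position ω zero    = v₀
  position ω (suc t) = step ω (position ω t) (port t)

  -- Every vertex has the same degree, so the ports advance by one modulo that
  -- degree whatever the labeling is.
  walk≡ : ∀ ω t → walk ω v₀ ℓ t ≡ leave ω (position ω t) (port t)
  walk≡ ω zero    = refl
  walk≡ ω (suc t) = trans (cong (next ω) (walk≡ ω t))
    (cong (λ i → leave ω (position ω (suc t)) (suc (toℕ i) mod n))
      (Inverse.strictlyInverseʳ (ω (position ω t)) (port t)))

  cycles-by : ∀ {ω s t} → s ℕ.< t → position ω s ≡ position ω t → port s ≡ port t → Cycles ω v₀ ℓ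
  cycles-by {ω} {s} {t} s<t eqᵖ eqˡ = s , t , s<t , cong src same , cong tgt same
    where
    same : walk ω v₀ ℓ s ≡ walk ω v₀ ℓ t
    same = trans (walk≡ ω s) (trans (cong₂ (leave ω) eqᵖ eqˡ) (sym (walk≡ ω t)))

  arcCount : ℕ → ℕ
  arcCount R = (suc R ℕ.+ suc R) ℕ.^ d ℕ.* n

  -- Pigeonhole on pairs of position and port: times 0 to `arcCount R` are one more than the
  -- available codes.
  confined⇒cycles : ∀ {ω R t} → arcCount R ℕ.≤ t → (∀ s → s ℕ.≤ t → norm (position ω s) ℕ.≤ R) →
    Cycles ω v₀ ℓ
  confined⇒cycles {ω} {R} {t} M≤t bound with Fin.pigeonhole (ℕ.n<1+n (arcCount R)) code
    where
    inside : (i : Fin (suc (arcCount R))) → norm (position ω (toℕ i)) ℕ.≤ R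
    inside i = bound (toℕ i) (ℕ.≤-trans (ℕ.≤-pred (Fin.toℕ<n i)) M≤t)
    code : Fin (suc (arcCount R)) → Fin (arcCount R)
    code i = combine (encode (position ω (toℕ i)) (inside i)) (port (toℕ i))
  ... | i , j , i<j , eq with Fin.combine-injective _ _ _ _ eq
  ...   | eqᵖ , eqˡ = cycles-by i<j (encode-injective _ _ _ _ eqᵖ) eqˡ

  -- The trap: d excursions from a vertex to its outer neighbours.

  outer : Site → Fin d → Site
  outer x j = neighbor x (outward x j)

  outer-injective : ∀ x → Injective _≡_ _≡_ (outer x)
  outer-injective x eq = outward-injective x (neighbor-injective x _ _ eq)

  -- Excursion `j` departs at time 2j + t and returns one step later. The condition constrains only
  -- labels at `x` and its outer neighbours, not the position, so finitely many prescribed labelings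
  -- can enforce it.
  Star : Labeling → ℕ → Site → Set
  Star ω t x = ∀ j → step ω x (port (toℕ j ℕ.* 2 ℕ.+ t)) ≡ outer x j ×
                     step ω (outer x j) (port (suc (toℕ j ℕ.* 2 ℕ.+ t))) ≡ x

  star-returns : ∀ {ω t x} → position ω t ≡ x → Star ω t x →
    ∀ m → m ℕ.≤ d → position ω (m ℕ.* 2 ℕ.+ t) ≡ x
  star-returns         at star zero    _   = at
  star-returns {ω} {t} {x} at star (suc m) m<d = begin
    step ω (step ω (position ω s) (port s)) (port (suc s))
      ≡⟨ cong (λ y → step ω (step ω y (port s)) (port (suc s)))
           (star-returns {ω} at star m (ℕ.<⇒≤ m<d)) ⟩
    step ω (step ω x (port s)) (port (suc s))
      ≡⟨ cong (λ y → step ω y (port (suc s)))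
           (subst (λ r → step ω x (port (r ℕ.* 2 ℕ.+ t)) ≡ outer x j) j≡m (proj₁ (star j))) ⟩
    step ω (outer x j) (port (suc s))
      ≡⟨ subst (λ r → step ω (outer x j) (port (suc (r ℕ.* 2 ℕ.+ t))) ≡ x) j≡m (proj₂ (star j)) ⟩
    x ∎
    where
    open ≡-Reasoning
    s = m ℕ.* 2 ℕ.+ t
    j = fromℕ< m<d
    j≡m : toℕ j ≡ m
    j≡m = Fin.toℕ-fromℕ< m<d

  -- The d excursions take 2d = n steps, after which both the vertex and the port are those of time
  -- `t`.
  star⇒cycles : ∀ {ω t x} → position ω t ≡ x → Star ω t x → Cycles ω v₀ ℓ
  star⇒cycles {ω} {t} at star = cycles-by (ℕ.m<n+m t (ℕ.>-nonZero⁻¹ n))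
    (trans at (sym (star-returns {ω} at star d ℕ.≤-refl))) (sym (port-periodic t))

  relabel : ∀ v → Permutation′ n → LocalLabeling v
  relabel v σ = neighbors v ↔-∘ σ

  -- The departures use the ports at offsets 2j < n, which are distinct, and go in distinct outward
  -- directions; the partial matching extends to a bijection.
  center-labeling : ∀ t x → ∃ λ (π : LocalLabeling x) →
    ∀ j → exit x π (port (toℕ j ℕ.* 2 ℕ.+ t)) ≡ outer x j
  center-labeling t x
    with extendInjection d (λ j → port (toℕ j ℕ.* 2 ℕ.+ t)) (outward x)
           evenPorts-injective (outward-injective x)
    where
    evenPorts-injective : Injective _≡_ _≡_ (λ (j : Fin d) → port (toℕ j ℕ.* 2 ℕ.+ t))
    evenPorts-injective {i} {j} eq = Fin.toℕ-injective (ℕ.*-cancelʳ-≡ (toℕ i) (toℕ j) 2 (port-injective t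
      (ℕ.*-monoˡ-< 2 (Fin.toℕ<n i)) (ℕ.*-monoˡ-< 2 (Fin.toℕ<n j)) eq))
  ... | σ , eq = relabel x σ , λ j → cong (neighbor x) (eq j)

  -- Only one port is prescribed, so one transposition of the standard labeling is enough.
  leaf-labeling : ∀ t x j → ∃ λ (π : LocalLabeling (outer x j)) →
    exit (outer x j) π (port (suc (toℕ j ℕ.* 2 ℕ.+ t))) ≡ x
  leaf-labeling t x j = relabel y (transpose i k) ,
    trans (cong (neighbor y) (transpose-matchˡ i k))
      (cong proj₁ (Inverse.strictlyInverseˡ (neighbors y) (x , y∼x)))
    where
    y = outer x j
    i = port (suc (toℕ j ℕ.* 2 ℕ.+ t))
    y∼x : LatticeAdj y x
    y∼x = lattice-sym {x = x} {y} (neighbor-adj x (outward x j))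
    k = Inverse.from (neighbors y) (x , y∼x)

  -- Conditional bounds by revealing the labels of one vertex.

  Agree : ∀ v → LocalLabeling v → LocalLabeling v → Set
  Agree v π ρ = ∀ i → exit v π i ≡ exit v ρ i

  labelings : ∀ v → List (LocalLabeling v)
  labelings v = map (relabel v) (permutations n)

  length-labelings : ∀ v → length (labelings v) ≡ n !
  length-labelings v = trans (List.length-map (relabel v) (permutations n)) (length-permutations n)

  labelings-complete : ∀ v (π : LocalLabeling v) → Any (Agree v π) (labelings v)
  labelings-complete v π = Any.map⁺
    (Any.map (λ {σ} → agree σ) (permutations-complete n (↔-sym (neighbors v) ↔-∘ π)))
    where
    agree : ∀ σ → (↔-sym (neighbors v) ↔-∘ π) Perm.≈ σ → Agree v π (relabel v σ)
    agree σ eq i = trans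
      (cong proj₁ (sym (Inverse.strictlyInverseˡ (neighbors v) (Inverse.to π i))))
      (cong (neighbor v) (eq i))

  -- All degrees are n, so this is 1/n! at every vertex; `v₀` is just a representative.
  u : ℚ
  u = uniformMass v₀

  private
    instance
      n!≢0 : ℕ.NonZero (n !)
      n!≢0 = n ℕ.!≢0

  Fresh : Site → Cylinder → Set
  Fresh v C = All (v ≢_) (map proj₁ (prescribed C))

  reveal : ∀ C v → Fresh v C → LocalLabeling v → Cylinder
  reveal C v fresh π = record
    { prescribed = (v , π) ∷ prescribed C
    ; distinct   = fresh ∷ distinct C
    }

  0≤μ : ∀ C → 0ℚ ℚ.≤ μ C
  0≤μ C = nonNeg (prescribed C)
    where
    nonNeg : ∀ ps → 0ℚ ℚ.≤ foldr (λ (v , _) q → uniformMass v ℚ.* q) 1ℚ ps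
    nonNeg []       = ℚ.nonNegative⁻¹ 1ℚ
    nonNeg (_ ∷ ps) = 0≤-* (ℚ.<⇒≤ (0<1/n (n !))) (nonNeg ps)

  total : List Cylinder → ℚ
  total = foldr (λ C q → μ C ℚ.+ q) 0ℚ

  total-++ : ∀ Bs Bs′ → total (Bs ++ Bs′) ≡ total Bs ℚ.+ total Bs′
  total-++ []       Bs′ = sym (ℚ.+-identityˡ (total Bs′))
  total-++ (B ∷ Bs) Bs′ = trans (cong (μ B ℚ.+_) (total-++ Bs Bs′))
    (sym (ℚ.+-assoc (μ B) (total Bs) (total Bs′)))

  -- Outer-measure form of "`E` without cycling has probability at most `q`". A finite list is
  -- enough because each exploration tree is finite.
  record NonCyclingCover (E : Labeling → Set) (q : ℚ) : Set where
    constructor cover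
    field
      cylinders : List Cylinder
      total≤    : total cylinders ℚ.≤ q
      covers    : ∀ ω → E ω → ¬ Cycles ω v₀ ℓ → Any (ω ∈ᶜ_) cylinders

  -- Conditionally on C, the walk fails to cycle with probability at most q.
  record Bounded (C : Cylinder) (q : ℚ) : Set where
    constructor bounded-by
    field nonCyclingCover : NonCyclingCover (_∈ᶜ C) (q ℚ.* μ C)

  bounded-by-1 : ∀ C → Bounded C 1ℚ
  bounded-by-1 C = bounded-by (cover [ C ]
    (ℚ.≤-reflexive (trans (ℚ.+-identityʳ (μ C)) (sym (ℚ.*-identityˡ (μ C)))))
    (λ ω ω∈C _ → here ω∈C))

  cycling⇒bounded : ∀ {C} q → 0ℚ ℚ.≤ q → (∀ ω → ω ∈ᶜ C → Cycles ω v₀ ℓ) → Bounded C q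
  cycling⇒bounded {C} q 0≤q cycles = bounded-by (cover []
    (0≤-* 0≤q (0≤μ C))
    (λ ω ω∈C ¬cycles → contradiction (cycles ω ω∈C) ¬cycles))

  -- The part of `C` whose labeling at `v` is on the list, so that covers can be assembled one
  -- labeling at a time.
  Branch : Cylinder → ∀ v → List (LocalLabeling v) → Labeling → Set
  Branch C v ρs ω = ω ∈ᶜ C × Any (Agree v (ω v)) ρs

  -- The mass of C with one more vertex revealed is u * μ C.
  share : Cylinder → ℚ → ℚ
  share C q = u ℚ.* (q ℚ.* μ C)

  module _ (C : Cylinder) (v : Site) (fresh : Fresh v C) where

    branch-∷ : ∀ {ρ ρs q q′} → Bounded (reveal C v fresh ρ) q → NonCyclingCover (Branch C v ρs) q′ →
      NonCyclingCover (Branch C v (ρ ∷ ρs)) (share C q ℚ.+ q′)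
    branch-∷ {ρ} {ρs} {q} {q′} (bounded-by (cover Bs total≤ covers)) (cover Bs′ total≤′ covers′) =
      cover (Bs ++ Bs′) bound covered
      where
      bound : total (Bs ++ Bs′) ℚ.≤ share C q ℚ.+ q′
      bound = subst₂ ℚ._≤_ (sym (total-++ Bs Bs′)) (cong (ℚ._+ q′) (exchange q u (μ C)))
        (ℚ.+-mono-≤ total≤ total≤′)
        where
        open +-*-Solver
        exchange : ∀ q u m → q ℚ.* (u ℚ.* m) ≡ u ℚ.* (q ℚ.* m)
        exchange = solve 3 (λ q u m → q :* (u :* m) := u :* (q :* m)) refl
      covered : ∀ ω → Branch C v (ρ ∷ ρs) ω → ¬ Cycles ω v₀ ℓ → Any (ω ∈ᶜ_) (Bs ++ Bs′)
      covered ω (ω∈C , here agree) ¬cycles = Any.++⁺ˡ (covers ω (agree ∷ ω∈C) ¬cycles)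
      covered ω (ω∈C , there any)  ¬cycles = Any.++⁺ʳ Bs (covers′ ω (ω∈C , any) ¬cycles)

    branches : ∀ {q} → (∀ ρ → Bounded (reveal C v fresh ρ) q) →
      ∀ ρs → NonCyclingCover (Branch C v ρs) (length ρs · share C q)
    branches bounded []       = cover [] ℚ.≤-refl λ { _ (_ , ()) _ }
    branches bounded (ρ ∷ ρs) = branch-∷ (bounded ρ) (branches bounded ρs)

    -- The `Any` proof singles out one entry that agrees with `π`; it gets the bound `q′`, and each
    -- of the other `m` entries gets `q`.
    branches-favouring : ∀ π {q q′} →
      (∀ ρ → Agree v π ρ → Bounded (reveal C v fresh ρ) q′) → (∀ ρ → Bounded (reveal C v fresh ρ) q) →
      ∀ ρs {m} → Any (Agree v π) ρs → length ρs ≡ suc m →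
      NonCyclingCover (Branch C v ρs) (m · share C q ℚ.+ share C q′)
    branches-favouring π {q} {q′} favoured bounded (ρ ∷ ρs) (here agree) refl =
      subst (NonCyclingCover (Branch C v (ρ ∷ ρs))) (ℚ.+-comm (share C q′) (length ρs · share C q))
        (branch-∷ (favoured ρ agree) (branches bounded ρs))
    branches-favouring π {q} {q′} favoured bounded (ρ ∷ ρs@(_ ∷ ρs′)) (there any) refl =
      subst (NonCyclingCover (Branch C v (ρ ∷ ρs)))
        (sym (ℚ.+-assoc (share C q) (length ρs′ · share C q) (share C q′)))
        (branch-∷ (bounded ρ) (branches-favouring π favoured bounded ρs any refl))

    branches⇒bounded : ∀ {q p} → p ≡ q ℚ.* μ C →
      NonCyclingCover (Branch C v (labelings v)) p → Bounded C q
    branches⇒bounded refl (cover Bs total≤ covers) =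
      bounded-by (cover Bs total≤ λ ω ω∈C → covers ω (ω∈C , labelings-complete v (ω v)))

    -- The n! branches weigh `u` each and n! times `u` is 1, so a bound common to all branches
    -- passes to `C` without loss.
    reveal-bounded : ∀ {q} → (∀ ρ → Bounded (reveal C v fresh ρ) q) → Bounded C q
    reveal-bounded {q} bounded = branches⇒bounded average (branches bounded (labelings v))
      where
      open ≡-Reasoning
      average : length (labelings v) · share C q ≡ q ℚ.* μ C
      average = begin
        length (labelings v) · share C q   ≡⟨ cong (_· share C q) (length-labelings v) ⟩
        (n !) · share C q                  ≡⟨ ×-assoc-* (n !) u (q ℚ.* μ C) ⟨
        ((n !) · u) ℚ.* (q ℚ.* μ C)        ≡⟨ cong (ℚ._* (q ℚ.* μ C)) (n·1/n≡1 (n !)) ⟩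
        1ℚ ℚ.* (q ℚ.* μ C)                 ≡⟨ ℚ.*-identityˡ (q ℚ.* μ C) ⟩
        q ℚ.* μ C                          ∎

    reveal-bounded-favouring : ∀ π {q q′} →
      (∀ ρ → Agree v π ρ → Bounded (reveal C v fresh ρ) q′) → (∀ ρ → Bounded (reveal C v fresh ρ) q) →
      Bounded C ((1ℚ ℚ.- u) ℚ.* q ℚ.+ u ℚ.* q′)
    reveal-bounded-favouring π {q} {q′} favoured bounded = branches⇒bounded average
      (branches-favouring π favoured bounded (labelings v) (labelings-complete v π)
        (trans (length-labelings v) (sym n!≡)))
      where
      open ≡-Reasoning
      -- The number of branches other than the favoured one; their total weight is 1 - u.
      m = ℕ.pred (n !)
      n!≡ : suc m ≡ n !
      n!≡ = ℕ.suc-pred (n !)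
      distrib : ∀ p q u q′ m → p ℚ.* (q ℚ.* m) ℚ.+ u ℚ.* (q′ ℚ.* m) ≡ (p ℚ.* q ℚ.+ u ℚ.* q′) ℚ.* m
      distrib = solve 5 (λ p q u q′ m →
        p :* (q :* m) :+ u :* (q′ :* m) := (p :* q :+ u :* q′) :* m) refl
        where open +-*-Solver
      average : m · share C q ℚ.+ share C q′ ≡ ((1ℚ ℚ.- u) ℚ.* q ℚ.+ u ℚ.* q′) ℚ.* μ C
      average = begin
        m · share C q ℚ.+ share C q′
          ≡⟨ cong (ℚ._+ share C q′) (×-assoc-* m u (q ℚ.* μ C)) ⟨
        (m · u) ℚ.* (q ℚ.* μ C) ℚ.+ share C q′
          ≡⟨ cong (λ p → p ℚ.* (q ℚ.* μ C) ℚ.+ share C q′)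
               (m·p≡1-p m (trans (cong (_· u) n!≡) (n·1/n≡1 (n !)))) ⟩
        (1ℚ ℚ.- u) ℚ.* (q ℚ.* μ C) ℚ.+ share C q′
          ≡⟨ distrib (1ℚ ℚ.- u) q u q′ (μ C) ⟩
        ((1ℚ ℚ.- u) ℚ.* q ℚ.+ u ℚ.* q′) ℚ.* μ C ∎

  -- Escaping a single trap.

  Within : ℕ → List (Σ Site LocalLabeling) → Set
  Within R = All (λ (v , _) → norm v ℕ.≤ R)

  beyond⇒fresh : ∀ {R v C} → Within R (prescribed C) → R ℕ.< norm v → Fresh v C
  beyond⇒fresh within R<v = All.map⁺ (All.map (λ { w≤R refl → ℕ.<⇒≱ R<v w≤R }) within)

  _∈ᴾ_ : Labeling → List (Σ Site LocalLabeling) → Set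
  ω ∈ᴾ ps = All (λ (v , π) → Agree v (ω v) π) ps

  -- The vertices of `ps` are revealed in turn. A wrong label hands over to `otherwise`; a right one
  -- continues with the rest of the list; once all are right the walk cycles. `refines` lets facts
  -- known on `C` survive the extra revelations.
  trap-bounded : ∀ {R q} ps {C} → Unique (map proj₁ ps) → All (λ (v , _) → Fresh v C) ps →
    Within R ps → Within R (prescribed C) →
    (∀ ω → ω ∈ᶜ C → ω ∈ᴾ ps → Cycles ω v₀ ℓ) →
    (∀ C′ → Within R (prescribed C′) → (∀ ω → ω ∈ᶜ C′ → ω ∈ᶜ C) → Bounded C′ q) →
    Bounded C ((1ℚ ℚ.- u ^ length ps) ℚ.* q)
  trap-bounded {q = q} [] {C} _ _ _ _ trapped _ =
    -- For the empty list the factor 1 - u^0 is 0, so the bound to meet is 0.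
    cycling⇒bounded _ (ℚ.≤-reflexive (sym (ℚ.*-zeroˡ q))) (λ ω ω∈C → trapped ω ω∈C [])
  trap-bounded {R} {q} ((v , π) ∷ ps) {C}
    (v∉ps ∷ distinct) (fresh ∷ freshes) (v≤R ∷ within) withinC trapped otherwise =
    subst (Bounded C) (1-^-step u q (length ps)) (reveal-bounded-favouring C v fresh π
      (λ ρ agree → trap-bounded ps {reveal C v fresh ρ} distinct (still-fresh ρ) within (v≤R ∷ withinC)
        (λ { ω (agreeρ ∷ ω∈C) ω∈ps → trapped ω ω∈C ((λ i → trans (agreeρ i) (sym (agree i))) ∷ ω∈ps) })
        (λ C′ within′ refines → otherwise C′ within′ (λ ω → All.tail ∘ refines ω)))
      (λ ρ → otherwise (reveal C v fresh ρ) (v≤R ∷ withinC) (λ ω → All.tail)))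
    where
    still-fresh : ∀ ρ → All (λ (w , _) → Fresh w (reveal C v fresh ρ)) ps
    still-fresh ρ = All.zipWith (λ (v≢w , fresh) → (v≢w ∘ sym) ∷ fresh) (All.map⁻ v∉ps , freshes)

  -- Exploring the labeling along the walk.

  -- `R` bounds the revealed vertices and the positions strictly before `t`. The current position
  -- `x` is exempt: its norm exceeding `R` is what signals an exit.
  record Explored (C : Cylinder) (t : ℕ) (x : Site) (R : ℕ) : Set where
    field
      within  : Within R (prescribed C)
      present : ∀ ω → ω ∈ᶜ C → position ω t ≡ x
      past    : ∀ ω → ω ∈ᶜ C → ∀ s → s ℕ.< t → norm (position ω s) ℕ.≤ R

  open Explored

  -- `u ^ suc d` is the probability that `x` and its d outer neighbours all carry the trap labels.
  r : ℚ
  r = 1ℚ ℚ.- u ^ suc d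

  0≤r : 0ℚ ℚ.≤ r
  0≤r = 0≤1-^ (suc d) (ℚ.<⇒≤ (0<1/n (n !))) (0≤1-unitFraction (n !))

  starLeaf : ℕ → ∀ x → Fin d → Σ Site LocalLabeling
  starLeaf t x j = outer x j , proj₁ (leaf-labeling t x j)

  starLabeling : ℕ → Site → List (Σ Site LocalLabeling)
  starLabeling t x = (x , proj₁ (center-labeling t x)) ∷ tabulate (starLeaf t x)

  length-starLabeling : ∀ t x → length (starLabeling t x) ≡ suc d
  length-starLabeling t x = cong suc (List.length-tabulate (starLeaf t x))

  starLabeling⇒Star : ∀ {ω} t x → ω ∈ᴾ starLabeling t x → Star ω t x
  starLabeling⇒Star t x (center ∷ leaves) j =
    trans (center _) (proj₂ (center-labeling t x) j) ,
    trans (All.tabulate⁻ leaves j _) (proj₂ (leaf-labeling t x j))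

  -- Everything revealed has norm at most `R`, while `x` and its outer neighbours lie beyond, so the
  -- whole star is still random.
  exit-bounded : ∀ {C t x R q} → Explored C t x R → R ℕ.< norm x →
    (∀ {C t x R} → Explored C t x R → Bounded C q) → Bounded C (r ℚ.* q)
  exit-bounded {C} {t} {x} {R} {q} explored R<x continue =
    subst (λ k → Bounded C ((1ℚ ℚ.- u ^ k) ℚ.* q)) (length-starLabeling t x)
      (trap-bounded (starLabeling t x) star-distinct star-fresh star-within
        (All.map (λ v≤R → ℕ.≤-trans v≤R R≤R′) (within explored))
        (λ ω ω∈C ω∈star → star⇒cycles {ω} (present explored ω ω∈C) (starLabeling⇒Star {ω} t x ω∈star))
        -- A failed trap only reveals labels: the walk resumes from the same time and vertex.
        (λ C′ within′ refines → continue record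
          { within  = within′
          ; present = λ ω → present explored ω ∘ refines ω
          ; past    = λ ω ω∈C′ s s<t → ℕ.≤-trans (past explored ω (refines ω ω∈C′) s s<t) R≤R′
          }))
    where
    -- The norm of the outer neighbours, so the new ball holds every vertex that the trap may have
    -- revealed.
    R′ = suc (norm x)
    R≤R′ : R ℕ.≤ R′
    R≤R′ = ℕ.≤-trans (ℕ.<⇒≤ R<x) (ℕ.n≤1+n (norm x))
    star-distinct : Unique (map proj₁ (starLabeling t x))
    star-distinct = All.map⁺ (All.tabulate⁺ (λ j x≡w →
        ℕ.1+n≢n (trans (sym (norm-outward x j)) (cong norm (sym x≡w))))) ∷
      subst Unique (sym (List.map-tabulate (starLeaf t x) proj₁)) (Unique.tabulate⁺ (outer-injective x))
    star-fresh : All (λ (v , _) → Fresh v C) (starLabeling t x)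
    star-fresh = beyond⇒fresh {C = C} (within explored) R<x ∷ All.tabulate⁺ (λ j →
      beyond⇒fresh {C = C} (within explored)
        (subst (R ℕ.<_) (sym (norm-outward x j)) (ℕ.m<n⇒m<1+n R<x)))
    star-within : Within R′ (starLabeling t x)
    star-within = ℕ.n≤1+n (norm x) ∷ All.tabulate⁺ (λ j → ℕ.≤-reflexive (norm-outward x j))

  confined : ∀ {C t x R} → Explored C t x R → norm x ℕ.≤ R →
    ∀ ω → ω ∈ᶜ C → ∀ s → s ℕ.≤ t → norm (position ω s) ℕ.≤ R
  confined {R = R} explored x≤R ω ω∈C s s≤t with ℕ.m≤n⇒m<n∨m≡n s≤t
  ... | inj₁ s<t  = past explored ω ω∈C s s<t
  ... | inj₂ refl = subst (λ y → norm y ℕ.≤ R) (sym (present explored ω ω∈C)) x≤R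

  advance : ∀ {C t x R π} → Explored C t x R → norm x ℕ.≤ R → (x , π) ∈ prescribed C →
    Explored C (suc t) (exit x π (port t)) R
  advance {C} {t} {x} {R} explored x≤R xπ∈C = record
    { within  = within explored
    ; present = λ ω ω∈C → trans (cong (λ y → step ω y (port t)) (present explored ω ω∈C))
        (All.lookup ω∈C xπ∈C (port t))
    ; past    = λ ω ω∈C s s<1+t → confined explored x≤R ω ω∈C s (ℕ.≤-pred s<1+t)
    }

  reveal-explored : ∀ {C t x R} (fresh : Fresh x C) π → Explored C t x R → norm x ℕ.≤ R →
    Explored (reveal C x fresh π) t x R
  reveal-explored fresh π explored x≤R = record
    { within  = x≤R ∷ within explored
    ; present = λ { ω (_ ∷ ω∈C) → present explored ω ω∈C }
    ; past    = λ { ω (_ ∷ ω∈C) → past explored ω ω∈C }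
    }

  -- Within a phase `R` is fixed and `fuel` counts the steps left until time `arcCount R`. The walk
  -- either leaves the ball first, and meets a trap, or stays long enough to cycle by pigeonhole.
  phase-bounded : ∀ {q} → 0ℚ ℚ.≤ q → (∀ {C t x R} → Explored C t x R → Bounded C q) →
    ∀ fuel {C t x R} → Explored C t x R → arcCount R ℕ.≤ t ℕ.+ fuel → Bounded C (r ℚ.* q)
  phase-bounded {q} 0≤q continue fuel {C} {t} {x} {R} explored enough with norm x ℕ.≤? R
  ... | no  x≰R = exit-bounded explored (ℕ.≰⇒> x≰R) continue
  phase-bounded {q} 0≤q continue zero {C} {t} {x} {R} explored enough | yes x≤R =
    cycling⇒bounded _ (0≤-* 0≤r 0≤q) (λ ω ω∈C →
      confined⇒cycles {ω} (subst (arcCount R ℕ.≤_) (ℕ.+-identityʳ t) enough) (confined explored x≤R ω ω∈C))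
  phase-bounded 0≤q continue (suc fuel) {C} {t} {x} {R} explored enough | yes x≤R
    with _∈?_ (Vec.≡-dec ℤ._≟_) x (map proj₁ (prescribed C))
  ... | yes x∈C with (_ , xπ∈C , refl) ← ∈-map⁻ proj₁ x∈C =
    phase-bounded 0≤q continue fuel (advance explored x≤R xπ∈C)
      (subst (arcCount R ℕ.≤_) (ℕ.+-suc t fuel) enough)
  -- Averaging over the labelings of `x` keeps the bound, and in each branch the next step is
  -- determined.
  ... | no  x∉C = reveal-bounded C x fresh (λ ρ →
    phase-bounded 0≤q continue fuel (advance (reveal-explored fresh ρ explored x≤R) x≤R (here refl))
      (subst (arcCount R ℕ.≤_) (ℕ.+-suc t fuel) enough))
    where
    fresh : Fresh x C
    fresh = All.¬Any⇒All¬ _ x∉C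

  -- Each phase contributes one factor `r`, and the state it ends in is the start of the next, with
  -- a possibly larger ball.
  explored-bounded : ∀ k {C t x R} → Explored C t x R → Bounded C (r ^ k)
  explored-bounded zero    {C} _        = bounded-by-1 C
  explored-bounded (suc k) {t = t} {R = R} explored =
    phase-bounded (0≤-^ k 0≤r) (explored-bounded k) (arcCount R) explored (ℕ.m≤n+m (arcCount R) t)

  -- From finite covers to a null set.

  enumerate : List Cylinder → ℕ → Maybe Cylinder
  enumerate []       _       = nothing
  enumerate (B ∷ Bs) zero    = just B
  enumerate (B ∷ Bs) (suc k) = enumerate Bs k

  enumerate-∋ : ∀ ω {Bs} → Any (ω ∈ᶜ_) Bs → ∃ λ k → ω ∈ᵇ enumerate Bs k
  enumerate-∋ ω (here {B} ω∈B) = 0 , B , refl , ω∈B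
  enumerate-∋ ω (there any)    = let (k , ω∈Bₖ) = enumerate-∋ ω any in suc k , ω∈Bₖ

  partialSum-suc : ∀ f m → partialSum f (suc m) ≡ f 0 ℚ.+ partialSum (f ∘ suc) m
  partialSum-suc f zero    = ℚ.+-comm 0ℚ (f 0)
  partialSum-suc f (suc m) = trans (cong (ℚ._+ f (suc m)) (partialSum-suc f m))
    (ℚ.+-assoc (f 0) (partialSum (f ∘ suc) m) (f (suc m)))

  0≤total : ∀ Bs → 0ℚ ℚ.≤ total Bs
  0≤total []       = ℚ.≤-refl
  0≤total (B ∷ Bs) = 0≤-+ (0≤μ B) (0≤total Bs)

  partialSum≤total : ∀ Bs m → partialSum (μᵇ ∘ enumerate Bs) m ℚ.≤ total Bs
  partialSum≤total Bs       zero    = 0≤total Bs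
  partialSum≤total []       (suc m) = ℚ.≤-trans (ℚ.≤-reflexive (ℚ.+-identityʳ _)) (partialSum≤total [] m)
  partialSum≤total (B ∷ Bs) (suc m) = ℚ.≤-trans
    (ℚ.≤-reflexive (partialSum-suc (μᵇ ∘ enumerate (B ∷ Bs)) m))
    (ℚ.+-monoʳ-≤ (μ B) (partialSum≤total Bs m))

  everything : Cylinder
  everything = record { prescribed = [] ; distinct = [] }

  -- With no past and nothing revealed, radius 0 is valid even if `v₀` is not the origin; the first
  -- phase then opens with an exit.
  initially-explored : Explored everything 0 v₀ 0
  initially-explored = record { within = [] ; present = λ _ _ → refl ; past = λ _ _ _ () }

  bounded⇒null : ∀ {q δ} → Bounded everything q → q ℚ.≤ δ →
    Σ (ℕ → Maybe Cylinder) λ B →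
      (∀ m → partialSum (λ k → μᵇ (B k)) m ℚ.≤ δ) ×
      (∀ ω → ¬ Cycles ω v₀ ℓ → ∃ λ m → ω ∈ᵇ B m)
  bounded⇒null {q} (bounded-by (cover Bs total≤ covers)) q≤δ = enumerate Bs ,
    (λ m → ℚ.≤-trans (partialSum≤total Bs m)
      (ℚ.≤-trans total≤ (ℚ.≤-trans (ℚ.≤-reflexive (ℚ.*-identityʳ q)) q≤δ))) ,
    λ ω ¬cycles → enumerate-∋ ω (covers ω [] ¬cycles)

  almostSurely-cycles : AlmostSurely (λ ω → Cycles ω v₀ ℓ)
  almostSurely-cycles δ 0<δ =
    -- `k` is the number of traps to be escaped before the remaining probability is at most `δ`.
    let (k , rᵏ≤δ) = powers-vanish (u ^ suc d) δ (0<-^ (suc d) (0<1/n (n !))) 0≤r 0<δ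
    in bounded⇒null (explored-bounded k initially-explored) rᵏ≤δ

theorem4p2 : (d : ℕ) → 1 ≤ d →
    (v₀ : Graph.V (ℤ^ d)) (ℓ : Fin (Graph.deg (ℤ^ d) v₀)) →
    RandomLabeling.AlmostSurely (ℤ^ d) (λ ω → BasicWalk.Cycles (ℤ^ d) ω v₀ ℓ)
theorem4p2 d _ v₀ ℓ = LatticeWalk.almostSurely-cycles d v₀ ℓ
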